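{- There is a function $f$ of $k$ such that for every positive integer $k$ there exist infinitely many $2$-layer $k$-planar graphs with $n$ vertices and $$m=\left\lfloor\sqrt{k/2}\right\rfloor n-\mathcal{O}(f(k))$$ edges; that is, for every $k\ge 1$ there are infinitely many $n$ for which some $2$-layer $k$-planar graph on $n$ vertices has $m=\lfloor\sqrt{k/2}\rfloor\, n-c$ edges, where $|c|$ is bounded by a constant depending only on $k$ (not on $n$).
   Context: All graphs are finite and simple (no loops or parallel edges). A topological $2$-layer graph is a bipartite graph $G=(U\,\dot\cup\,V,E)$, $E\subseteq U\times V$, drawn in the plane so that the vertices of $U$ and of $V$ are distinct points on two horizontal lines $L_u$ and $L_v$, respectively, and edges are $y$-monotone Jordan arcs; the drawing is assumed simple, i.e. adjacent edges do not cross and independent edges cross at most once. Denote the vertices by $u_1,\dots,u_p$ along $L_u$ and $v_1,\dots,v_q$ along $L_v$ in left-to-right order, $n=p+q$. (Thus edges $(u_i,v_x)$ and $(u_j,v_y)$ with $i<j$ cross if and only if $x>y$.) A topological $2$-layer graph is $k$-planar if each edge is crossed at most $k$ times. A bipartite graph is $2$-layer $k$-planar if it is isomorphic to the underlying abstract graph of some topological $2$-layer $k$-planar graph. -}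

module Defs where

open import Level using (0ℓ)
open import Data.Bool using (Bool)
open import Data.Empty using (⊥)
open import Data.Fin using (Fin)
import Data.Fin as Fin
import Data.Fin.Properties as Fin
open import Data.List using (length; filter; cartesianProduct; allFin)
open import Data.Nat using (ℕ; zero; suc; _*_; _≤_; _<_; _≤?_; z≤n; s≤s)
open import Data.Nat.Properties using (≤-trans; m≤m+n; m≤m*n; ≰⇒>)
open import Data.Product using (Σ-syntax; ∃-syntax; _×_; _,_)
open import Data.Sum using (_⊎_; inj₁; inj₂)
open import Function.Bundles using (_↔_; _⇔_; Inverse)
open import Relation.Binary using (Rel; REL; Decidable; Symmetric; Irreflexive)
open import Relation.Binary.PropositionalEquality using (_≡_; _≢_; refl)
open import Relation.Nullary using (yes; no)
open import Relation.Nullary.Decidable using (_×-dec_; _⊎-dec_)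

record SimpleGraph (V : Set) : Set₁ where
  field
    Adj    : Rel V 0ℓ
    adj?   : Decidable Adj
    sym    : Symmetric Adj
    irrefl : Irreflexive _≡_ Adj

open SimpleGraph

-- Each unordered edge is counted once, at its increasing pair of endpoints.
edgeCount : ∀ {n} → SimpleGraph (Fin n) → ℕ
edgeCount {n} G =
  length (filter (λ (x , y) → (x Fin.<? y) ×-dec adj? G x y)
                 (cartesianProduct (allFin n) (allFin n)))

Bipartite : ∀ {V} → SimpleGraph V → Set
Bipartite {V} G = Σ[ side ∈ (V → Bool) ] (∀ {x y} → Adj G x y → side x ≢ side y)

_≅_ : ∀ {V W} → SimpleGraph V → SimpleGraph W → Set
_≅_ {V} {W} G H =
  Σ[ φ ∈ V ↔ W ] (∀ x y → Adj G x y ⇔ Adj H (Inverse.to φ x) (Inverse.to φ y))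

-- A topological 2-layer graph, up to the data that determines its crossings:
-- `Fin p` and `Fin q` list the vertices on the lines L_u and L_v from left to
-- right.  In a simple drawing with y-monotone edges, which pairs of edges
-- cross depends only on these two orders, so the arcs are not recorded.
record TwoLayerGraph (p q : ℕ) : Set₁ where
  field
    E  : REL (Fin p) (Fin q) 0ℓ
    E? : Decidable E

open TwoLayerGraph

Cross : ∀ {p q} → Fin p × Fin q → Fin p × Fin q → Set
Cross (i , x) (j , y) =
  (i Fin.< j × y Fin.< x) ⊎ (j Fin.< i × x Fin.< y)

cross? : ∀ {p q} → Decidable (Cross {p} {q})
cross? (i , x) (j , y) =
  ((i Fin.<? j) ×-dec (y Fin.<? x)) ⊎-dec ((j Fin.<? i) ×-dec (x Fin.<? y))

crossings : ∀ {p q} → TwoLayerGraph p q → Fin p × Fin q → ℕ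
crossings {p} {q} D e =
  length (filter (λ (j , y) → E? D j y ×-dec cross? e (j , y))
                 (cartesianProduct (allFin p) (allFin q)))

KPlanar : ∀ {p q} → ℕ → TwoLayerGraph p q → Set
KPlanar k D = ∀ i x → E D i x → crossings D (i , x) ≤ k

underlying : ∀ {p q} → TwoLayerGraph p q → SimpleGraph (Fin p ⊎ Fin q)
underlying {p} {q} D = record
  { Adj = A ; adj? = A? ; sym = λ {a} {b} → A-sym a b ; irrefl = A-irrefl }
  where
  A : Rel (Fin p ⊎ Fin q) 0ℓ
  A (inj₁ i) (inj₂ x) = E D i x
  A (inj₂ x) (inj₁ i) = E D i x
  A (inj₁ _) (inj₁ _) = ⊥
  A (inj₂ _) (inj₂ _) = ⊥

  A? : Decidable A
  A? (inj₁ i) (inj₂ x) = E? D i x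
  A? (inj₂ x) (inj₁ i) = E? D i x
  A? (inj₁ _) (inj₁ _) = no λ ()
  A? (inj₂ _) (inj₂ _) = no λ ()

  A-sym : ∀ a b → A a b → A b a
  A-sym (inj₁ _) (inj₂ _) e = e
  A-sym (inj₂ _) (inj₁ _) e = e

  A-irrefl : Irreflexive _≡_ A
  A-irrefl {inj₁ _} refl ()
  A-irrefl {inj₂ _} refl ()

TwoLayerKPlanar : ∀ {V} → ℕ → SimpleGraph V → Set₁
TwoLayerKPlanar k G =
  Bipartite G ×
  (∃[ p ] ∃[ q ] Σ[ D ∈ TwoLayerGraph p q ] (KPlanar k D × G ≅ underlying D))

-- The greatest s ≤ b with s² ≤ k/2, or 0 if there is none that is positive.
searchRoot : ℕ → ℕ → ℕ
searchRoot k zero = 0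
searchRoot k (suc b) with 2 * (suc b * suc b) ≤? k
... | yes _ = suc b
... | no  _ = searchRoot k b

-- The integer part of the real number √(k/2).
⌊√_/2⌋ : ℕ → ℕ
⌊√ k /2⌋ = searchRoot k k

-- ⌊√ k /2⌋ is the s with s ≤ √(k/2) < s + 1.
⌊√k/2⌋-spec : ∀ k → let s = ⌊√ k /2⌋ in
              2 * (s * s) ≤ k × k < 2 * (suc s * suc s)
⌊√k/2⌋-spec k = go k (≤-trans (m≤m*n (suc k) (suc k)) (m≤m+n _ _))
  where
  go : ∀ b → k < 2 * (suc b * suc b) → let s = searchRoot k b in
       2 * (s * s) ≤ k × k < 2 * (suc s * suc s)
  go zero h = z≤n , h
  go (suc b) h with 2 * (suc b * suc b) ≤? k
  ... | yes le  = le , h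
  ... | no  nle = go b (≰⇒> nle)

{-# OPTIONS --safe #-}

-- Put s = ⌊√(k/2)⌋ and d = 2s, and join u_i to the d consecutive vertices
-- v_i , … , v_{i+d-1}.  Relative to u_i, the edges crossing (u_i , v_{i+a}) from
-- the right correspond to pairs r₁ < r₂ ≤ a and those crossing it from the left
-- to pairs a < r₁ < r₂ < d.  Hence there are at most d(d-1)/2 ≤ 2s² ≤ k of them.
-- With N vertices u_i and N + d vertices v_x there are dN = sn - 2s² edges.
module Submission where

open import Defs
open import Data.Bool using (true; false; if_then_else_)
open import Data.Fin using (Fin; toℕ; fromℕ<; splitAt; _↑ˡ_; _↑ʳ_)
import Data.Fin as Fin
open import Data.Fin.Properties
  using (toℕ<n; toℕ-injective; toℕ-fromℕ<; toℕ-↑ˡ; toℕ-↑ʳ; splitAt-↑ˡ; splitAt-↑ʳ;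
         splitAt⁻¹-↑ˡ; splitAt⁻¹-↑ʳ; ↑ˡ-injective; ↑ʳ-injective; injective⇒≤; +↔⊎)
open import Data.Integer using (+_; _-_; _⊖_; ∣_∣; ℤ)
import Data.Integer.Properties as ℤ
open import Data.List using (List; []; _∷_; _++_; map; filter; length; lookup; upTo; allFin; cartesianProduct)
open import Data.List.Properties using (length-map; length-++; length-upTo; length-tabulate)
open import Data.List.Membership.Propositional using (_∈_)
open import Data.List.Membership.Propositional.Properties
  using (∈-map⁺; ∈-map⁻; ∈-filter⁺; ∈-filter⁻; ∈-cartesianProduct⁺; ∈-allFin; ∈-upTo⁺; ∈-++⁺ˡ; ∈-++⁺ʳ; ∈-lookup)
open import Data.List.Membership.Setoid.Properties using (index-injective)
import Data.List.Relation.Unary.All as All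
open import Data.List.Relation.Unary.AllPairs using (_∷_)
open import Data.List.Relation.Unary.Any using (index)
open import Data.List.Relation.Unary.Unique.Propositional using (Unique)
import Data.List.Relation.Unary.Unique.Propositional.Properties as Unique
open import Data.Nat using (ℕ; zero; suc; pred; _+_; _*_; _∸_; _≤_; _<_; _≤?_; _<?_; z≤n; s≤s)
open import Data.Nat.Properties
open import Data.Nat.Tactic.RingSolver using (solve-∀)
open import Data.Product using (Σ-syntax; ∃-syntax; _×_; _,_; proj₁; proj₂)
open import Data.Sum using (_⊎_; inj₁; inj₂)
open import Function using (_∘_)
open import Function.Bundles using (mk⇔)
open import Function.Definitions using (Injective)
open import Relation.Binary.PropositionalEquality
open import Relation.Nullary using (does; contradiction)
open import Relation.Nullary.Decidable using (_×-dec_; dec-true; dec-false)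

open SimpleGraph using (Adj; adj?)

-- Counting with duplicate-free lists

lookup-injective : ∀ {A : Set} {xs : List A} → Unique xs → Injective _≡_ _≡_ (lookup xs)
lookup-injective (_ ∷ _) {Fin.zero} {Fin.zero} _ = refl
lookup-injective (x∉ ∷ _) {Fin.zero} {Fin.suc j} eq = contradiction eq (All.lookup x∉ (∈-lookup j))
lookup-injective (x∉ ∷ _) {Fin.suc i} {Fin.zero} eq = contradiction (sym eq) (All.lookup x∉ (∈-lookup i))
lookup-injective (_ ∷ u) {Fin.suc i} {Fin.suc j} eq = cong Fin.suc (lookup-injective u eq)

-- Pigeonhole: sending a position in `xs` to a position of the same entry in `ys` is injective,
-- because equal positions in `ys` carry equal entries and `xs` does not repeat any.
unique∧⊆⇒length≤ : ∀ {A : Set} {xs ys : List A} →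
  Unique xs → (∀ {x} → x ∈ xs → x ∈ ys) → length xs ≤ length ys
unique∧⊆⇒length≤ {A} u sub = injective⇒≤ {f = λ i → index (sub (∈-lookup i))}
  (lookup-injective u ∘ index-injective (setoid A) (sub (∈-lookup _)) (sub (∈-lookup _)))

unique-pairs : ∀ m n → Unique (cartesianProduct (allFin m) (allFin n))
unique-pairs m n = Unique.cartesianProduct⁺ (Unique.allFin⁺ m) (Unique.allFin⁺ n)

∈-pairs : ∀ {m n} (i : Fin m) (j : Fin n) → (i , j) ∈ cartesianProduct (allFin m) (allFin n)
∈-pairs i j = ∈-cartesianProduct⁺ (∈-allFin i) (∈-allFin j)

length-cartesianProduct : ∀ {A B : Set} (xs : List A) (ys : List B) →
  length (cartesianProduct xs ys) ≡ length xs * length ys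
length-cartesianProduct [] ys = refl
length-cartesianProduct (x ∷ xs) ys =
  trans (length-++ (map (x ,_) ys)) (cong₂ _+_ (length-map (x ,_) ys) (length-cartesianProduct xs ys))

length-pairs : ∀ m n → length (cartesianProduct (allFin m) (allFin n)) ≡ m * n
length-pairs m n = trans (length-cartesianProduct (allFin m) (allFin n))
  (cong₂ _*_ (length-tabulate {n = m} (λ i → i)) (length-tabulate {n = n} (λ i → i)))

-- Pairs of offsets that encode crossings

decreasingPairs : ℕ → List (ℕ × ℕ)
decreasingPairs zero = []
decreasingPairs (suc n) = map (n ,_) (upTo n) ++ decreasingPairs n

∈-decreasingPairs : ∀ {n a b} → b < a → a < n → (a , b) ∈ decreasingPairs n
∈-decreasingPairs {suc n} {a} b<a a<1+n with m<1+n⇒m<n∨m≡n a<1+n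
... | inj₁ a<n  = ∈-++⁺ʳ (map (n ,_) (upTo n)) (∈-decreasingPairs b<a a<n)
... | inj₂ refl = ∈-++⁺ˡ (∈-map⁺ (n ,_) (∈-upTo⁺ b<a))

-- The exact value of the left side is n(n-1). Doubling avoids a division and rounding up to n²
-- avoids truncated subtraction; for n = 2s half of the bound is 2s², still at most k.
length-decreasingPairs : ∀ n → 2 * length (decreasingPairs n) ≤ n * n
length-decreasingPairs zero = z≤n
length-decreasingPairs (suc n) = begin
  2 * length (map (n ,_) (upTo n) ++ decreasingPairs n)
    ≡⟨ cong (2 *_) (length-++ (map (n ,_) (upTo n))) ⟩
  2 * (length (map (n ,_) (upTo n)) + length (decreasingPairs n))
    ≡⟨ cong (λ l → 2 * (l + length (decreasingPairs n))) (trans (length-map (n ,_) (upTo n)) (length-upTo n)) ⟩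
  2 * (n + length (decreasingPairs n))
    ≡⟨ *-distribˡ-+ 2 n _ ⟩
  2 * n + 2 * length (decreasingPairs n)
    ≤⟨ +-monoʳ-≤ (2 * n) (length-decreasingPairs n) ⟩
  2 * n + n * n
    ≤⟨ n≤1+n _ ⟩
  suc (2 * n + n * n)
    ≡⟨ square n ⟩
  suc n * suc n ∎
  where
  open ≤-Reasoning
  square : ∀ n → suc (2 * n + n * n) ≡ suc n * suc n
  square = solve-∀

-- The band graph and its crossings

band : ∀ d p q → TwoLayerGraph p q
band d p q = record
  { E  = λ i x → toℕ i ≤ toℕ x × toℕ x < toℕ i + d
  ; E? = λ i x → (toℕ i ≤? toℕ x) ×-dec (toℕ x <? toℕ i + d)
  }

-- The edge of the band encoded by a pair r₁ < r₂ < d among those crossing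
-- (i , i + a): it starts at i + r₁ if it lies to the right, and at i + r₂ - d
-- if it lies to the left.
crossingEdge : (d i a : ℕ) → ℕ × ℕ → ℕ × ℕ
crossingEdge d i a (r₂ , r₁) =
  if does (r₂ ≤? a) then (i + r₁ , i + pred r₂) else (i + r₂ ∸ d , i + r₁)

-- With r = j - i and t = y - i one has r ≤ t < a. Since r = t is possible, the code is (t + 1, r):
-- this makes the pair strict, and t + 1 ≤ a is exactly the test that selects the first branch of
-- `crossingEdge`.
rightCrossing : ∀ {d i a j y} → a < d → i < j → j ≤ y → y < i + a →
  (j , y) ∈ map (crossingEdge d i a) (decreasingPairs d)
rightCrossing {d} {i} {a} a<d i<j j≤y y<i+a
  with r , refl ← m≤n⇒∃[o]m+o≡n (<⇒≤ i<j)
     | t , refl ← m≤n⇒∃[o]m+o≡n (≤-trans (<⇒≤ i<j) j≤y)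
  with t<a ← +-cancelˡ-< i t a y<i+a
  = subst (_∈ map (crossingEdge d i a) (decreasingPairs d)) encode
      (∈-map⁺ (crossingEdge d i a)
        (∈-decreasingPairs (s≤s (+-cancelˡ-≤ i r t j≤y)) (≤-<-trans t<a a<d)))
  where
  encode : crossingEdge d i a (suc t , r) ≡ (i + r , i + t)
  encode rewrite dec-true (suc t ≤? a) t<a = refl

-- With r = y - i and t = j + d - i one has a < r < t < d, so the pair (t, r) fails the test t ≤ a
-- and takes the second branch. There i + t = j + d, so subtracting d returns j without truncation.
leftCrossing : ∀ {d i a j y} → j < i → i + a < y → y < j + d →
  (j , y) ∈ map (crossingEdge d i a) (decreasingPairs d)
leftCrossing {d} {i} {a} {j} j<i i+a<y y<j+d
  with r , refl ← m≤n⇒∃[o]m+o≡n (≤-trans (m≤m+n i a) (<⇒≤ i+a<y))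
  with t , i+t≡j+d ← m≤n⇒∃[o]m+o≡n (≤-trans (m≤m+n i r) (<⇒≤ y<j+d))
  with r<t ← +-cancelˡ-< i r t (subst (i + r <_) (sym i+t≡j+d) y<j+d)
  = subst (_∈ map (crossingEdge d i a) (decreasingPairs d)) encode
      (∈-map⁺ (crossingEdge d i a) (∈-decreasingPairs r<t
        (+-cancelˡ-< i t d (subst (_< i + d) (sym i+t≡j+d) (+-monoˡ-< d j<i)))))
  where
  encode : crossingEdge d i a (t , r) ≡ (j , i + r)
  encode rewrite dec-false (t ≤? a) (<⇒≱ (<-trans (+-cancelˡ-< i a r i+a<y) r<t))
               | i+t≡j+d | m+n∸n≡m j d = refl

-- The crossing edges form a duplicate-free list that is covered by the images of the pairs r₁ < r₂
-- < d, so they are at most as many as these pairs.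
band-crossings : ∀ {d p q} (i : Fin p) (x : Fin q) → TwoLayerGraph.E (band d p q) i x →
  2 * crossings (band d p q) (i , x) ≤ d * d
band-crossings {d} {p} {q} i x (i≤x , x<i+d)
  with a , i+a≡x ← m≤n⇒∃[o]m+o≡n i≤x = begin
  2 * length crossing
    ≡⟨ cong (2 *_) (length-map toℕ² crossing) ⟨
  2 * length (map toℕ² crossing)
    ≤⟨ *-monoʳ-≤ 2 (unique∧⊆⇒length≤ (Unique.map⁺ toℕ²-injective (Unique.filter⁺ P? (unique-pairs p q))) encoded) ⟩
  2 * length (map (crossingEdge d (toℕ i) a) (decreasingPairs d))
    ≡⟨ cong (2 *_) (length-map (crossingEdge d (toℕ i) a) (decreasingPairs d)) ⟩
  2 * length (decreasingPairs d)
    ≤⟨ length-decreasingPairs d ⟩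
  d * d ∎
  where
  open ≤-Reasoning
  P? = λ ((j , y) : Fin p × Fin q) → TwoLayerGraph.E? (band d p q) j y ×-dec cross? (i , x) (j , y)
  crossing = filter P? (cartesianProduct (allFin p) (allFin q))
  -- The comparison takes place in `ℕ × ℕ`, since near the ends of the band a code can decode to
  -- positions where no vertex exists.
  toℕ² : Fin p × Fin q → ℕ × ℕ
  toℕ² (j , y) = toℕ j , toℕ y
  toℕ²-injective : Injective _≡_ _≡_ toℕ²
  toℕ²-injective eq = cong₂ _,_ (toℕ-injective (cong proj₁ eq)) (toℕ-injective (cong proj₂ eq))
  a<d : a < d
  a<d = +-cancelˡ-< (toℕ i) a d (subst (_< toℕ i + d) (sym i+a≡x) x<i+d)
  encoded : ∀ {e} → e ∈ map toℕ² crossing → e ∈ map (crossingEdge d (toℕ i) a) (decreasingPairs d)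
  encoded e∈ with (j , y) , jy∈ , refl ← ∈-map⁻ toℕ² e∈
    with proj₂ (∈-filter⁻ P? {xs = cartesianProduct (allFin p) (allFin q)} jy∈)
  ... | (j≤y , _) , inj₁ (i<j , y<x) = rightCrossing a<d i<j j≤y (subst (toℕ y <_) (sym i+a≡x) y<x)
  ... | (_ , y<j+d) , inj₂ (j<i , x<y) = leftCrossing j<i (subst (_< toℕ y) (sym i+a≡x) x<y) y<j+d

-- The abstract graph of a drawing and its number of edges

flatten : ∀ {p q} → TwoLayerGraph p q → SimpleGraph (Fin (p + q))
flatten {p} {q} D = record
  { Adj    = λ a b → Adj (underlying D) (splitAt p a) (splitAt p b)
  ; adj?   = λ a b → adj? (underlying D) (splitAt p a) (splitAt p b)
  ; sym    = λ {a} {b} → SimpleGraph.sym (underlying D) {splitAt p a} {splitAt p b}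
  ; irrefl = λ {a} {b} eq → SimpleGraph.irrefl (underlying D) (cong (splitAt p) eq)
  }

flatten-bipartite : ∀ {p q} (D : TwoLayerGraph p q) → Bipartite (flatten D)
flatten-bipartite {p} {q} D = side ∘ splitAt p , λ {a} {b} → opposite (splitAt p a) (splitAt p b)
  where
  side : Fin p ⊎ Fin q → _
  side (inj₁ _) = false
  side (inj₂ _) = true
  opposite : ∀ a b → Adj (underlying D) a b → side a ≢ side b
  opposite (inj₁ _) (inj₂ _) _ ()
  opposite (inj₂ _) (inj₁ _) _ ()

-- Adjacency in `flatten D` is pulled back along `splitAt`, which is the forward map of `+↔⊎`; hence
-- this bijection is an isomorphism by definition.
flatten-kPlanar : ∀ {k p q} (D : TwoLayerGraph p q) → KPlanar k D → TwoLayerKPlanar k (flatten D)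
flatten-kPlanar D planar =
  flatten-bipartite D , _ , _ , D , planar , +↔⊎ , λ _ _ → mk⇔ (λ e → e) (λ e → e)

-- With p + d vertices on the second line, i + r is a valid position for all i < p and r < d, so
-- each u_i keeps its full degree d. Thus (i, r) parametrizes the edges, and two inclusions of
-- duplicate-free lists give equality.
edgeCount-flatten-band : ∀ d p → edgeCount (flatten (band d p (p + d))) ≡ p * d
edgeCount-flatten-band d p = trans
  (≤-antisym (unique∧⊆⇒length≤ (Unique.filter⁺ P? (unique-pairs n n)) edge⇒∈)
             (unique∧⊆⇒length≤ (Unique.map⁺ edge-injective (unique-pairs p d)) ∈⇒edge))
  (trans (length-map edge (cartesianProduct (allFin p) (allFin d))) (length-pairs p d))
  where
  n = p + (p + d)
  G = flatten (band d p (p + d))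
  P? = λ ((a , b) : Fin n × Fin n) → (a Fin.<? b) ×-dec adj? G a b
  shift : Fin p → Fin d → Fin (p + d)
  shift i r = fromℕ< (+-mono-< (toℕ<n i) (toℕ<n r))
  toℕ-shift : ∀ i r → toℕ (shift i r) ≡ toℕ i + toℕ r
  toℕ-shift i r = toℕ-fromℕ< _
  edge : Fin p × Fin d → Fin n × Fin n
  edge (i , r) = i ↑ˡ (p + d) , p ↑ʳ shift i r

  edge-injective : Injective _≡_ _≡_ edge
  edge-injective {i , r} {i′ , r′} eq with refl ← ↑ˡ-injective (p + d) i i′ (cong proj₁ eq) =
    cong (i ,_) (toℕ-injective (+-cancelˡ-≡ (toℕ i) _ _ (begin
      toℕ i + toℕ r      ≡⟨ toℕ-shift i r ⟨
      toℕ (shift i r)    ≡⟨ cong toℕ (↑ʳ-injective p _ _ (cong proj₂ eq)) ⟩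
      toℕ (shift i r′)   ≡⟨ toℕ-shift i r′ ⟩
      toℕ i + toℕ r′     ∎)))
    where open ≡-Reasoning

  left<right : ∀ (i : Fin p) (x : Fin (p + d)) → toℕ (i ↑ˡ (p + d)) < toℕ (p ↑ʳ x)
  left<right i x = subst₂ _<_ (sym (toℕ-↑ˡ i _)) (sym (toℕ-↑ʳ p x)) (<-≤-trans (toℕ<n i) (m≤m+n p _))

  ∈⇒edge : ∀ {e} → e ∈ map edge (cartesianProduct (allFin p) (allFin d)) →
           e ∈ filter P? (cartesianProduct (allFin n) (allFin n))
  ∈⇒edge e∈ with (i , r) , _ , refl ← ∈-map⁻ edge e∈ =
    ∈-filter⁺ P? (∈-pairs _ _) (left<right i (shift i r) , adjacent)
    where
    adjacent : Adj G (i ↑ˡ (p + d)) (p ↑ʳ shift i r)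
    adjacent rewrite splitAt-↑ˡ p i (p + d) | splitAt-↑ʳ p (p + d) (shift i r) | toℕ-shift i r =
      m≤m+n _ _ , +-monoʳ-< (toℕ i) (toℕ<n r)

  edge⇒∈ : ∀ {e} → e ∈ filter P? (cartesianProduct (allFin n) (allFin n)) →
           e ∈ map edge (cartesianProduct (allFin p) (allFin d))
  edge⇒∈ {a , b} e∈ with proj₂ (∈-filter⁻ P? {xs = cartesianProduct (allFin n) (allFin n)} e∈)
  ... | a<b , ab with splitAt p a in eqa | splitAt p b in eqb
  -- `edgeCount` counts increasing pairs and the u_i are numbered before the v_x, so each edge is
  -- seen only from its u-end.
  ... | inj₂ x | inj₁ j =
    contradiction (subst₂ Fin._<_ (sym (splitAt⁻¹-↑ʳ eqa)) (sym (splitAt⁻¹-↑ˡ eqb)) a<b)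
                  (<-asym (left<right j x))
  ... | inj₁ i | inj₂ x with i≤x , x<i+d ← ab
    with r , i+r≡x ← m≤n⇒∃[o]m+o≡n i≤x =
    subst (_∈ map edge _) (cong₂ _,_ (splitAt⁻¹-↑ˡ eqa) (trans (cong (p ↑ʳ_) shift≡x) (splitAt⁻¹-↑ʳ eqb)))
      (∈-map⁺ edge (∈-pairs i (fromℕ< r<d)))
    where
    open ≡-Reasoning
    r<d : r < d
    r<d = +-cancelˡ-< (toℕ i) r d (subst (_< toℕ i + d) (sym i+r≡x) x<i+d)
    shift≡x : shift i (fromℕ< r<d) ≡ x
    shift≡x = toℕ-injective (begin
      toℕ (shift i (fromℕ< r<d))    ≡⟨ toℕ-shift i (fromℕ< r<d) ⟩
      toℕ i + toℕ (fromℕ< r<d)      ≡⟨ cong (λ t → toℕ i + t) (toℕ-fromℕ< r<d) ⟩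
      toℕ i + r                     ≡⟨ i+r≡x ⟩
      toℕ x                         ∎)

-- The choice d = 2s and the final count

band-kPlanar : ∀ {k p q} s → 2 * (s * s) ≤ k → KPlanar k (band (2 * s) p q)
band-kPlanar {p = p} {q} s 2s²≤k i x e = ≤-trans
  (*-cancelˡ-≤ 2 (≤-trans (band-crossings {2 * s} {p} {q} i x e) (≤-reflexive (square s)))) 2s²≤k
  where
  square : ∀ s → 2 * s * (2 * s) ≡ 2 * (2 * (s * s))
  square = solve-∀

n≡m+o⇒+m≡+n-+o : ∀ {m n o} → n ≡ m + o → + m ≡ + n - + o
n≡m+o⇒+m≡+n-+o {m} {o = o} refl = begin
  + m                 ≡⟨ cong +_ (m+n∸n≡m m o) ⟨
  + (m + o ∸ o)       ≡⟨ ℤ.⊖-≥ (m≤n+m o m) ⟨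
  (m + o) ⊖ o         ≡⟨ ℤ.m-n≡m⊖n (m + o) o ⟨
  + (m + o) - + o     ∎
  where open ≡-Reasoning

theorem12 : Σ[ f ∈ (ℕ → ℕ) ]
    (∀ (k : ℕ) → 1 ≤ k →
    ∀ (N : ℕ) → ∃[ n ] (N ≤ n ×
    Σ[ G ∈ SimpleGraph (Fin n) ]
    (TwoLayerKPlanar k G ×
    Σ[ c ∈ ℤ ] (+ edgeCount G ≡ + (⌊√ k /2⌋ * n) - c × ∣ c ∣ ≤ f k))))
theorem12 = (λ k → k) , λ k _ N →
  -- For k = 1 this is s = 0: the band is edgeless and both sides of the count are 0.
  let s = ⌊√ k /2⌋
      2s²≤k = proj₁ (⌊√k/2⌋-spec k)
      D = band (2 * s) N (N + 2 * s)
  -- The requested lower bound N doubles as the number of vertices u_i.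
  in N + (N + 2 * s) , m≤m+n N _ , flatten D , flatten-kPlanar D (band-kPlanar s 2s²≤k) ,
     -- The deficit c = 2s² does not depend on N, and 2s² ≤ k is why f(k) = k suffices.
     + (2 * (s * s)) ,
     n≡m+o⇒+m≡+n-+o (trans (count s N) (cong (_+ 2 * (s * s)) (sym (edgeCount-flatten-band (2 * s) N)))) ,
     2s²≤k
  where
  count : ∀ s N → s * (N + (N + 2 * s)) ≡ N * (2 * s) + 2 * (s * s)
  count = solve-∀
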